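{- Let $D$ be a finite simple digraph with at least one vertex. Then $F(D)=0$ if and only if $D$ is a directed cycle.
   Context: A finite simple digraph $D=(V,A)$ has finite nonempty vertex set $V$ and arc set $A$ consisting of ordered pairs of distinct vertices (no loops, no parallel arcs; both $(u,v)$ and $(v,u)$ may be present). $N_D^+(v)=\{u:(v,u)\in A\}$. Zero forcing: for $S\subseteq V$ let $B^0(S)=S$ and $B^{i+1}(S)=B^i(S)\cup\{w:\{w\}=N_D^+(v)\setminus B^i(S)\text{ for some }v\in B^i(S)\}$. $S$ is a zero forcing set (ZFS) if $B^t(S)=V$ for some $t\ge 0$, and a failed zero forcing set (FZFS) otherwise. The failed zero forcing number $F(D)$ is the largest cardinality of an FZFS of $D$. $D$ is a directed cycle if its vertices can be labeled $v_1,\dots,v_n$ so that its arcs are exactly $(v_1,v_2),(v_2,v_3),\dots,(v_{n-1},v_n),(v_n,v_1)$, where $n\ge 2$ (for $n=2$ this is the digraph with both arcs between two vertices); by convention the digraph with a single vertex and no arcs also counts as a directed cycle. -}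

module Defs where

open import Data.Bool.Properties using () renaming (_≟_ to _≟ᵇ_)
open import Data.Fin.Base using (Fin; toℕ)
open import Data.Fin.Permutation using (Permutation′; _⟨$⟩ʳ_)
open import Data.Fin.Properties using (any?)
open import Data.Fin.Subset using (Subset; _∈_; _∪_; _─_; ⁅_⁆; ⊤; ∣_∣)
open import Data.Fin.Subset.Properties using (_∈?_)
open import Data.Nat.Base using (ℕ; zero; suc; _≤_; NonZero)
open import Data.Nat.DivMod using (_mod_)
open import Data.Product.Base using (∃; _×_)
open import Data.Sum.Base using (_⊎_)
open import Data.Vec.Base using (tabulate)
open import Data.Vec.Properties using (≡-dec)
open import Function.Bundles using (_⇔_)
open import Level using (0ℓ)
open import Relation.Binary.Core using (Rel)
open import Relation.Binary.Definitions using (Decidable; Irreflexive)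
open import Relation.Binary.PropositionalEquality.Core using (_≡_)
open import Relation.Nullary.Decidable using (Dec; does; _×-dec_)
open import Relation.Nullary.Negation using (¬_)

-- Finite simple digraphs on the vertex set Fin n.  Only the truth value of
-- Arc u v is ever used, so there are no parallel arcs.
record Digraph (n : ℕ) : Set₁ where
  field
    Arc      : Rel (Fin n) 0ℓ
    arc?     : Decidable Arc
    loopless : Irreflexive _≡_ Arc

open Digraph public

module _ {n : ℕ} (D : Digraph n) where

  N⁺ : Fin n → Subset n
  N⁺ v = tabulate (λ u → does (arc? D v u))

  Forces : Subset n → Fin n → Fin n → Set
  Forces X v w = v ∈ X × ⁅ w ⁆ ≡ N⁺ v ─ X

  forces? : ∀ X v w → Dec (Forces X v w)
  forces? X v w = (v ∈? X) ×-dec ≡-dec _≟ᵇ_ ⁅ w ⁆ (N⁺ v ─ X)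

  forced : Subset n → Subset n
  forced X = tabulate (λ w → does (any? (λ v → forces? X v w)))

  B : ℕ → Subset n → Subset n
  B zero    S = S
  B (suc i) S = B i S ∪ forced (B i S)

  ZFS : Subset n → Set
  ZFS S = ∃ λ t → B t S ≡ ⊤

  FZFS : Subset n → Set
  FZFS S = ¬ ZFS S

  -- The graph of F: "F(D) = k", i.e. k is the largest cardinality of a failed
  -- zero forcing set.  At most one k satisfies this; one exists when n ≥ 1,
  -- as the empty set then fails.
  IsFailedZeroForcingNumber : ℕ → Set
  IsFailedZeroForcingNumber k = (∃ λ S → FZFS S × ∣ S ∣ ≡ k) × (∀ S → FZFS S → ∣ S ∣ ≤ k)

next : ∀ {n} .{{_ : NonZero n}} → Fin n → Fin n
next {n} i = suc (toℕ i) mod n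

-- The second alternative is the conventional case of a single vertex.
IsDirectedCycle : ∀ {n} .{{_ : NonZero n}} → Digraph n → Set
IsDirectedCycle {n} D =
  (2 ≤ n × ∃ λ (v : Permutation′ n) → ∀ x y →
     Arc D x y ⇔ (∃ λ i → x ≡ v ⟨$⟩ʳ i × y ≡ v ⟨$⟩ʳ next i))
  ⊎ (n ≡ 1 × ∀ x y → ¬ Arc D x y)

{-# OPTIONS --safe #-}

-- Call X stable if no vertex outside X is forced by X.  A stable proper subset
-- is a failed zero forcing set, so F(D) = 0 exactly when no nonempty proper
-- subset is stable.  Applied to singletons (n ≥ 2), this says that every vertex
-- v has exactly one out-neighbour f v.  By pigeonhole some x satisfies
-- fᵈ x = x with 1 ≤ d ≤ n; the set {x , f x , … , fᵈ⁻¹ x} is stable, hence it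
-- is everything, so d = n and D is the cycle x → f x → … → x.  Conversely, on
-- a directed cycle a single vertex forces its way around.
module Submission where

open import Defs
open import Data.Fin.Base using (Fin; zero; suc; toℕ; punchOut)
open import Data.Fin.Permutation using (Permutation′; permutation; _⟨$⟩ʳ_; _⟨$⟩ˡ_; inverseˡ; inverseʳ)
open import Data.Fin.Properties
  using (any?; pigeonhole; injective⇒≤; punchOut-injective; toℕ<n; toℕ≤n;
         toℕ-fromℕ<; toℕ-injective; _≟_)
open import Data.Fin.Subset
  using (Subset; _∈_; _∉_; _⊆_; _∪_; _─_; ⁅_⁆; ⊤; ⊥; ∣_∣; Nonempty)
open import Data.Fin.Subset.Properties
  using (_∈?_; nonempty?; ∈⊤; ⊆⊤; ∉⊥; x∈⁅x⁆; x∈⁅y⁆⇒x≡y; ⊆-antisym; ∣⊥∣≡0; ∣⁅x⁆∣≡1;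
         p⊆q⇒∣p∣≤∣q∣; p─q⊆p; p⊆p∪q; q⊆p∪q; x∈p∪q⁻; x∈p∧x∉q⇒x∈p─q; Empty-unique)
open import Data.Nat.Base
  using (ℕ; zero; suc; _+_; _*_; _∸_; _≤_; z≤n; s≤s; _≤′_;
         ≤′-reflexive; ≤′-step; NonZero; >-nonZero)
open import Data.Nat.DivMod
  using (_/_; _%_; _mod_; m%n<n; m%n%n≡m%n; %-distribˡ-+; m≡m%n+[m/n]*n; [m+n]%n≡m%n; m<n⇒m%n≡m)
open import Data.Nat.GeneralisedArithmetic using (fold; fold-+)
open import Data.Nat.Properties
  using (≤⇒≤′; ≤-trans; ≤-antisym; ≤-refl; ≤-reflexive; ≤-pred; <⇒≤; 1+n≰n; m<n⇒0<n∸m; m∸n≤m;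
         m∸n+n≡m; +-assoc; +-mono-≤)
open import Data.Product.Base using (∃; _×_; _,_; proj₁; proj₂)
open import Data.Sum.Base using (inj₁; inj₂)
open import Data.Vec.Base using (tabulate)
open import Data.Vec.Properties using ([]=⇒lookup; lookup⇒[]=; lookup∘tabulate)
open import Function.Base using (_∘_; id)
open import Function.Bundles using (_⇔_; mk⇔; module Equivalence)
open import Function.Definitions using (Injective; StrictlySurjective)
open import Level using (0ℓ)
open import Relation.Binary.PropositionalEquality
  using (_≡_; _≢_; refl; sym; trans; cong; subst; module ≡-Reasoning)
open import Relation.Nullary.Decidable using (yes; no; does; dec-true; decidable-stable)
open import Relation.Nullary.Negation using (contradiction)
open import Relation.Unary using (Pred; Decidable)

-- Subsets and self-maps of finite sets.

module _ {n} {P : Pred (Fin n) 0ℓ} (P? : Decidable P) where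

  comprehension : Subset n
  comprehension = tabulate (λ x → does (P? x))

  ∈-comprehension⁺ : ∀ {x} → P x → x ∈ comprehension
  ∈-comprehension⁺ {x} px =
    lookup⇒[]= x _ (trans (lookup∘tabulate _ x) (dec-true (P? x) px))

  ∈-comprehension⁻ : ∀ {x} → x ∈ comprehension → P x
  ∈-comprehension⁻ {x} x∈ with P? x | trans (sym (lookup∘tabulate (λ y → does (P? y)) x)) ([]=⇒lookup x∈)
  ... | yes px | _  = px
  ... | no _   | ()

universal⇒≡⊤ : ∀ {n} {X : Subset n} → (∀ x → x ∈ X) → X ≡ ⊤
universal⇒≡⊤ ∀∈ = ⊆-antisym ⊆⊤ (λ {x} _ → ∀∈ x)

Nonempty⇒1≤∣p∣ : ∀ {n} {p : Subset n} → Nonempty p → 1 ≤ ∣ p ∣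
Nonempty⇒1≤∣p∣ {p = p} (x , x∈p) = subst (_≤ ∣ p ∣) (∣⁅x⁆∣≡1 x)
  (p⊆q⇒∣p∣≤∣q∣ (λ y∈ → subst (_∈ p) (sym (x∈⁅y⁆⇒x≡y x y∈)) x∈p))

-- A missed value `i` could be punched out of the codomain, leaving an injection of `Fin (suc n)`
-- into `Fin n`.
injective⇒strictlySurjective : ∀ {n} {g : Fin n → Fin n} →
                               Injective _≡_ _≡_ g → StrictlySurjective _≡_ g
injective⇒strictlySurjective {suc n} {g} inj i with any? (λ y → g y ≟ i)
... | yes hit = hit
... | no miss = contradiction (injective⇒≤ {f = λ y → punchOut (i≢g y)} inj′) 1+n≰n
  where
  i≢g : ∀ y → i ≢ g y
  i≢g y eq = miss (y , sym eq)
  inj′ : Injective _≡_ _≡_ (λ y → punchOut (i≢g y))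
  inj′ {x} {y} eq = inj (punchOut-injective (i≢g x) (i≢g y) eq)

section⇒injective : ∀ {m n} (f : Fin m → Fin n) (g : Fin n → Fin m) →
                    (∀ y → f (g y) ≡ y) → Injective _≡_ _≡_ g
section⇒injective f g f∘g {x} {y} eq = trans (sym (f∘g x)) (trans (cong f eq) (f∘g y))

-- The section `g` is injective, hence onto by finiteness, so `x` may be taken to be some `g y`.
section⇒retraction : ∀ {n} (f g : Fin n → Fin n) →
                     (∀ y → f (g y) ≡ y) → ∀ x → g (f x) ≡ x
section⇒retraction f g f∘g x
  with y , refl ← injective⇒strictlySurjective (section⇒injective f g f∘g) x = cong g (f∘g y)

strictlySurjective⇒≤ : ∀ {m n} (f : Fin m → Fin n) → StrictlySurjective _≡_ f → n ≤ m
strictlySurjective⇒≤ f surj =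
  injective⇒≤ (section⇒injective f (λ y → proj₁ (surj y)) (λ y → proj₂ (surj y)))

strictlySurjective⇒permutation : ∀ {n} (f : Fin n → Fin n) → StrictlySurjective _≡_ f →
                                 ∃ λ (π : Permutation′ n) → ∀ i → π ⟨$⟩ʳ i ≡ f i
strictlySurjective⇒permutation {n} f surj =
  permutation f g f∘g (section⇒retraction f g f∘g) , λ _ → refl
  where
  g : Fin n → Fin n
  g y = proj₁ (surj y)
  f∘g : ∀ y → f (g y) ≡ y
  f∘g y = proj₂ (surj y)

-- Walking around the cycle of indices with `next`.

suc-% : ∀ m n .{{_ : NonZero n}} → suc (m % n) % n ≡ suc m % n
suc-% m n = begin
  suc (m % n) % n             ≡⟨ %-distribˡ-+ 1 (m % n) n ⟩
  (1 % n + m % n % n) % n     ≡⟨ cong (λ z → (1 % n + z) % n) (m%n%n≡m%n m n) ⟩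
  (1 % n + m % n) % n         ≡⟨ %-distribˡ-+ 1 m n ⟨
  suc m % n                   ∎
  where open ≡-Reasoning

toℕ-mod : ∀ m n .{{_ : NonZero n}} → toℕ (m mod n) ≡ m % n
toℕ-mod m n = toℕ-fromℕ< (m%n<n m n)

module _ {n} .{{_ : NonZero n}} where

  -- The reductions made at each step can be postponed to a single one at the end.
  toℕ-fold-next : ∀ (i : Fin n) j → toℕ (fold i next j) ≡ (j + toℕ i) % n
  toℕ-fold-next i zero    = sym (m<n⇒m%n≡m (toℕ<n i))
  toℕ-fold-next i (suc j) = begin
    toℕ (next (fold i next j))       ≡⟨ toℕ-mod _ n ⟩
    suc (toℕ (fold i next j)) % n    ≡⟨ cong (λ z → suc z % n) (toℕ-fold-next i j) ⟩
    suc ((j + toℕ i) % n) % n        ≡⟨ suc-% (j + toℕ i) n ⟩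
    suc (j + toℕ i) % n              ∎
    where open ≡-Reasoning

  next-reaches : ∀ (i k : Fin n) → ∃ λ j → j ≤ n + n × fold i next j ≡ k
  -- `n ∸ toℕ i` steps wrap from `i` around to index zero, and `toℕ k` further steps arrive at `k`.
  next-reaches i k = toℕ k + (n ∸ toℕ i) , +-mono-≤ (toℕ≤n k) (m∸n≤m n (toℕ i)) ,
    toℕ-injective (begin
      toℕ (fold i next (toℕ k + (n ∸ toℕ i)))  ≡⟨ toℕ-fold-next i (toℕ k + (n ∸ toℕ i)) ⟩
      (toℕ k + (n ∸ toℕ i) + toℕ i) % n        ≡⟨ cong (_% n) (+-assoc (toℕ k) _ _) ⟩
      (toℕ k + ((n ∸ toℕ i) + toℕ i)) % n      ≡⟨ cong (λ z → (toℕ k + z) % n) (m∸n+n≡m (toℕ≤n i)) ⟩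
      (toℕ k + n) % n                          ≡⟨ [m+n]%n≡m%n (toℕ k) n ⟩
      toℕ k % n                                ≡⟨ m<n⇒m%n≡m (toℕ<n k) ⟩
      toℕ k                                    ∎)
    where open ≡-Reasoning

-- Iterates of a map at a periodic point.

module _ {a} {A : Set a} {f : A → A} {x : A} {d : ℕ} (period : fold x f d ≡ x) where

  fold-multiple : ∀ k → fold x f (k * d) ≡ x
  fold-multiple zero    = refl
  fold-multiple (suc k) = begin
    fold x f (d + k * d)           ≡⟨ fold-+ x f d ⟩
    fold (fold x f (k * d)) f d    ≡⟨ cong (λ z → fold z f d) (fold-multiple k) ⟩
    fold x f d                     ≡⟨ period ⟩
    x                              ∎
    where open ≡-Reasoning

  fold-% : .{{_ : NonZero d}} → ∀ m → fold x f (m % d) ≡ fold x f m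
  fold-% m = begin
    fold x f (m % d)                        ≡⟨ cong (λ z → fold z f (m % d)) (fold-multiple (m / d)) ⟨
    fold (fold x f (m / d * d)) f (m % d)   ≡⟨ fold-+ x f (m % d) ⟨
    fold x f (m % d + m / d * d)            ≡⟨ cong (fold x f) (m≡m%n+[m/n]*n m d) ⟨
    fold x f m                              ∎
    where open ≡-Reasoning

  fold-mod : .{{_ : NonZero d}} → ∀ m → fold x f (toℕ (m mod d)) ≡ fold x f m
  fold-mod m = trans (cong (fold x f) (toℕ-mod m d)) (fold-% m)

  -- The iterates of `x` carry `next` to `f`: at the last index, where `next` wraps to zero, the
  -- period absorbs the jump.
  fold-next : .{{_ : NonZero d}} → ∀ (i : Fin d) → fold x f (toℕ (next i)) ≡ f (fold x f (toℕ i))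
  fold-next i = fold-mod (suc (toℕ i))

-- Among the iterates of `y` with exponents `0` to `n`, two coincide. The earlier one is the
-- periodic point, and the gap between the exponents is `d`.
eventually-periodic : ∀ {n} (f : Fin n → Fin n) → Fin n →
                      ∃ λ x → ∃ λ d → 1 ≤ d × d ≤ n × fold x f d ≡ x
eventually-periodic {n} f y
  with i , j , i<j , fⁱ≡fʲ ← pigeonhole ≤-refl (λ (i : Fin (suc n)) → fold y f (toℕ i)) =
  fold y f (toℕ i) , toℕ j ∸ toℕ i , m<n⇒0<n∸m i<j ,
  ≤-trans (m∸n≤m (toℕ j) (toℕ i)) (≤-pred (toℕ<n j)) , (begin
    fold (fold y f (toℕ i)) f (toℕ j ∸ toℕ i)  ≡⟨ fold-+ y f (toℕ j ∸ toℕ i) ⟨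
    fold y f (toℕ j ∸ toℕ i + toℕ i)           ≡⟨ cong (fold y f) (m∸n+n≡m (<⇒≤ i<j)) ⟩
    fold y f (toℕ j)                           ≡⟨ fⁱ≡fʲ ⟨
    fold y f (toℕ i)                           ∎)
  where open ≡-Reasoning

-- Forcing and stable sets.

module _ {n} (D : Digraph n) where

  ∈N⁺⇒Arc : ∀ {v u} → u ∈ N⁺ D v → Arc D v u
  ∈N⁺⇒Arc {v} = ∈-comprehension⁻ (arc? D v)

  Arc⇒∈N⁺ : ∀ {v u} → Arc D v u → u ∈ N⁺ D v
  Arc⇒∈N⁺ {v} = ∈-comprehension⁺ (arc? D v)

  module _ {X : Subset n} where

    Forces⇒Arc : ∀ {v w} → Forces D X v w → Arc D v w
    Forces⇒Arc {v} {w} (_ , eq) = ∈N⁺⇒Arc (p─q⊆p (N⁺ D v) X (subst (w ∈_) eq (x∈⁅x⁆ w)))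

    Forces⇒unique : ∀ {v w u} → Forces D X v w → Arc D v u → u ∉ X → u ≡ w
    Forces⇒unique {w = w} {u} (_ , eq) v→u u∉X =
      x∈⁅y⁆⇒x≡y w (subst (u ∈_) (sym eq) (x∈p∧x∉q⇒x∈p─q (Arc⇒∈N⁺ v→u) u∉X))

    unique⇒Forces : ∀ {v w} → v ∈ X → w ∉ X → Arc D v w → (∀ {u} → Arc D v u → u ≡ w) →
                    Forces D X v w
    unique⇒Forces {v} {w} v∈X w∉X v→w unique = v∈X , ⊆-antisym
      (λ u∈ → subst (_∈ N⁺ D v ─ X) (sym (x∈⁅y⁆⇒x≡y w u∈)) (x∈p∧x∉q⇒x∈p─q (Arc⇒∈N⁺ v→w) w∉X))
      (λ u∈ → subst (_∈ ⁅ w ⁆) (sym (unique (∈N⁺⇒Arc (p─q⊆p (N⁺ D v) X u∈)))) (x∈⁅x⁆ w))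

    ∈forced⇒Forces : ∀ {w} → w ∈ forced D X → ∃ λ v → Forces D X v w
    ∈forced⇒Forces = ∈-comprehension⁻ (λ w → any? (λ v → forces? D X v w))

    Forces⇒∈forced : ∀ {v w} → Forces D X v w → w ∈ forced D X
    Forces⇒∈forced {v} v→w = ∈-comprehension⁺ (λ w → any? (λ v → forces? D X v w)) (v , v→w)

    stable⇒B≡ : forced D X ⊆ X → ∀ t → B D t X ≡ X
    stable⇒B≡ stable zero = refl
    -- The induction hypothesis reduces the next round to one application of forcing to `X` itself.
    stable⇒B≡ stable (suc t) rewrite stable⇒B≡ stable t = ⊆-antisym X∪⊆X (p⊆p∪q (forced D X))
      where
      X∪⊆X : X ∪ forced D X ⊆ X
      X∪⊆X x∈ with x∈p∪q⁻ X (forced D X) x∈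
      ... | inj₁ x∈X = x∈X
      ... | inj₂ x∈f = stable x∈f

    -- If `X` missed `x`, no round would ever add it, so `X` would be a failed set with at least one
    -- element, contradicting the maximum `0`. Membership is decidable, so this refutation suffices.
    stable⇒full : IsFailedZeroForcingNumber D 0 → Nonempty X → forced D X ⊆ X → ∀ x → x ∈ X
    stable⇒full (_ , max) X≠∅ stable x = decidable-stable (x ∈? X) λ x∉X →
      1+n≰n (≤-trans (Nonempty⇒1≤∣p∣ X≠∅) (max X λ (t , full) →
        x∉X (subst (x ∈_) (trans (sym full) (stable⇒B≡ stable t)) ∈⊤)))

  -- From a directed cycle to zero forcing.

  B-mono : ∀ S {s t} → s ≤′ t → B D s S ⊆ B D t S
  B-mono S (≤′-reflexive refl) = id
  B-mono S (≤′-step s≤′t)      = p⊆p∪q _ ∘ B-mono S s≤′t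

  -- Either `w` is present already and persists, or it is the only out-neighbour of `v` still
  -- missing and gets forced in this round.
  out-neighbour⇒∈B : ∀ {S t v w} → Arc D v w → (∀ {u} → Arc D v u → u ≡ w) →
                     v ∈ B D t S → w ∈ B D (suc t) S
  out-neighbour⇒∈B {S} {t} {w = w} v→w unique v∈ with w ∈? B D t S
  ... | yes w∈ = p⊆p∪q _ w∈
  ... | no  w∉ = q⊆p∪q (B D t S) _ (Forces⇒∈forced (unique⇒Forces v∈ w∉ v→w unique))

  ∅-FZFS : Fin n → FZFS D ⊥
  ∅-FZFS x (t , full) = ∉⊥ (subst (x ∈_) (trans (sym full) (stable⇒B≡ ∅-stable t)) ∈⊤)
    where
    ∅-stable : forced D ⊥ ⊆ ⊥
    ∅-stable w∈ = contradiction (proj₁ (proj₂ (∈forced⇒Forces w∈))) ∉⊥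

  nonempty-ZFS⇒F≡0 : Fin n → (∀ S → Nonempty S → ZFS D S) → IsFailedZeroForcingNumber D 0
  nonempty-ZFS⇒F≡0 x zfs = (⊥ , ∅-FZFS x , ∣⊥∣≡0 n) , bound
    where
    bound : ∀ S → FZFS D S → ∣ S ∣ ≤ 0
    bound S failed with nonempty? S
    ... | yes S≠∅ = contradiction (zfs S S≠∅) failed
    ... | no  S=∅ = ≤-reflexive (trans (cong ∣_∣ (Empty-unique S=∅)) (∣⊥∣≡0 n))

  cycle⇒ZFS : .{{_ : NonZero n}} (v : Permutation′ n) →
    (∀ x y → Arc D x y ⇔ (∃ λ i → x ≡ v ⟨$⟩ʳ i × y ≡ v ⟨$⟩ʳ next i)) →
    ∀ S → Nonempty S → ZFS D S
  -- The bound from `next-reaches` is the same for all targets, so `n + n` is one time by which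
  -- every vertex has been reached.
  cycle⇒ZFS v arcs S (x , x∈S) = n + n , universal⇒≡⊤ full
    where
    open Equivalence
    start : Fin n
    start = v ⟨$⟩ˡ x
    arc : ∀ i → Arc D (v ⟨$⟩ʳ i) (v ⟨$⟩ʳ next i)
    arc i = arcs _ _ .from (i , refl , refl)
    v-injective : Injective _≡_ _≡_ (v ⟨$⟩ʳ_)
    v-injective = section⇒injective (v ⟨$⟩ˡ_) (v ⟨$⟩ʳ_) (λ _ → inverseˡ v)
    unique : ∀ i {u} → Arc D (v ⟨$⟩ʳ i) u → u ≡ v ⟨$⟩ʳ next i
    -- The arc comes with its own index `k`; injectivity of `v` identifies it with `i`.
    unique i i→u with k , vi≡vk , u≡ ← arcs _ _ .to i→u =
      trans u≡ (cong (λ z → v ⟨$⟩ʳ next z) (sym (v-injective vi≡vk)))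
    reached : ∀ t → v ⟨$⟩ʳ fold start next t ∈ B D t S
    reached zero    = subst (_∈ S) (sym (inverseʳ v)) x∈S
    reached (suc t) = out-neighbour⇒∈B {S} {t} (arc _) (unique _) (reached t)
    full : ∀ y → y ∈ B D (n + n) S
    full y with j , j≤ , eq ← next-reaches start (v ⟨$⟩ˡ y) =
      subst (_∈ B D (n + n) S) (trans (cong (v ⟨$⟩ʳ_) eq) (inverseʳ v)) (B-mono S (≤⇒≤′ j≤) (reached j))

  -- From a zero failed zero forcing number to a directed cycle.

  module _ (F≡0 : IsFailedZeroForcingNumber D 0) where

    -- The vertex `x` makes the singleton of `v` proper, hence not stable, so `v` forces some `w`.
    -- Every out-neighbour of `v` lies outside the singleton because there are no loops, and so
    -- equals `w`.
    functional : ∀ {v x} → x ≢ v → ∃ λ w → Arc D v w × (∀ {u} → Arc D v u → u ≡ w)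
    functional {v} {x} x≢v with any? (forces? D ⁅ v ⁆ v)
    ... | yes (w , v→w) = w , Forces⇒Arc v→w , λ {u} v→u →
          Forces⇒unique v→w v→u (λ u∈ → loopless D (sym (x∈⁅y⁆⇒x≡y v u∈)) v→u)
    ... | no v↛ = contradiction (x∈⁅y⁆⇒x≡y v (stable⇒full F≡0 (v , x∈⁅x⁆ v) stable x)) x≢v
      where
      stable : forced D ⁅ v ⁆ ⊆ ⁅ v ⁆
      stable {w} w∈ with u , u→w ← ∈forced⇒Forces w∈ =
        contradiction (w , subst (λ z → Forces D ⁅ v ⁆ z w) (x∈⁅y⁆⇒x≡y v (proj₁ u→w)) u→w) v↛

    module _ (f : Fin n → Fin n) (unique : ∀ {v u} → Arc D v u → u ≡ f v) where

      -- A vertex forced by a member `u` of the orbit can only be `f u`, which is again in the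
      -- orbit; thus the orbit is stable and nonempty.
      periodic-orbit-full : ∀ {x d} .{{_ : NonZero d}} → fold x f d ≡ x →
                            StrictlySurjective _≡_ (λ (i : Fin d) → fold x f (toℕ i))
      periodic-orbit-full {x} {d} period y =
        ∈-comprehension⁻ orbit? (stable⇒full F≡0
          -- `0 mod d` serves as the first index, since `d` is not syntactically a successor.
          (x , ∈-comprehension⁺ orbit? (0 mod d , fold-mod period 0)) stable y)
        where
        orbit? : Decidable (λ y → ∃ λ (i : Fin d) → fold x f (toℕ i) ≡ y)
        orbit? y = any? (λ i → fold x f (toℕ i) ≟ y)
        stable : forced D (comprehension orbit?) ⊆ comprehension orbit?
        stable w∈ with u , u→w ← ∈forced⇒Forces w∈
          with i , eq ← ∈-comprehension⁻ orbit? (proj₁ u→w) =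
          ∈-comprehension⁺ orbit? (next i ,
            trans (fold-next period i) (trans (cong f eq) (sym (unique (Forces⇒Arc u→w)))))

      -- The `d` iterates cover all `n` vertices, so the pigeonhole bound on `d` is attained.
      cyclic-orbit : .{{_ : NonZero n}} → Fin n → ∃ λ x → fold x f n ≡ x
      cyclic-orbit y with x , d , 1≤d , d≤n , period ← eventually-periodic f y =
        x , subst (λ d → fold x f d ≡ x) (≤-antisym d≤n n≤d) period
        where
        n≤d : n ≤ d
        n≤d = strictlySurjective⇒≤ (fold x f ∘ toℕ) (periodic-orbit-full {{>-nonZero 1≤d}} period)

      functional⇒cycle : .{{_ : NonZero n}} → Fin n → (∀ v → Arc D v (f v)) →
        ∃ λ (v : Permutation′ n) →
          ∀ x y → Arc D x y ⇔ (∃ λ i → x ≡ v ⟨$⟩ʳ i × y ≡ v ⟨$⟩ʳ next i)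
      functional⇒cycle y arc =
        let x , period = cyclic-orbit y
            -- With period exactly `n`, the orbit map is a surjection of `Fin n` onto itself, so it
            -- can serve as the labelling.
            v , v≗ = strictlySurjective⇒permutation (fold x f ∘ toℕ) (periodic-orbit-full period)
        in v , conjugate⇒arcs v λ i →
             trans (v≗ (next i)) (trans (fold-next period i) (cong f (sym (v≗ i))))
        where
        -- The arcs are exactly the pairs of `u` and `f u`, and `v` conjugates `next` to `f`.
        conjugate⇒arcs : (v : Permutation′ n) → (∀ i → v ⟨$⟩ʳ next i ≡ f (v ⟨$⟩ʳ i)) →
          ∀ x y → Arc D x y ⇔ (∃ λ i → x ≡ v ⟨$⟩ʳ i × y ≡ v ⟨$⟩ʳ next i)
        conjugate⇒arcs v v-next u w = mk⇔
          (λ u→w → v ⟨$⟩ˡ u , sym (inverseʳ v) ,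
            trans (unique u→w) (trans (cong f (sym (inverseʳ v))) (sym (v-next (v ⟨$⟩ˡ u)))))
          (λ { (i , refl , refl) → subst (Arc D (v ⟨$⟩ʳ i)) (sym (v-next i)) (arc (v ⟨$⟩ʳ i)) })

-- The two implications, with the single vertex treated apart.

F≡0⇒cycle : ∀ {n} .{{_ : NonZero n}} (D : Digraph n) →
            IsFailedZeroForcingNumber D 0 → IsDirectedCycle D
F≡0⇒cycle {suc zero} D F≡0 = inj₂ (refl , λ { zero zero → loopless D refl })
F≡0⇒cycle {suc (suc n)} D F≡0 = inj₁ (s≤s (s≤s z≤n) ,
  functional⇒cycle D F≡0 (proj₁ ∘ out) (λ {v} → proj₂ (proj₂ (out v))) zero (λ v → proj₁ (proj₂ (out v))))
  where
  -- With at least two vertices, each `v` has the distinct companion that `functional` requires.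
  other : ∀ (v : Fin (suc (suc n))) → ∃ λ x → x ≢ v
  other zero    = suc zero , λ ()
  other (suc _) = zero , λ ()
  out : ∀ v → ∃ λ w → Arc D v w × (∀ {u} → Arc D v u → u ≡ w)
  out v = functional D F≡0 (proj₂ (other v))

cycle⇒F≡0 : ∀ {n} .{{_ : NonZero n}} (D : Digraph n) →
            IsDirectedCycle D → IsFailedZeroForcingNumber D 0
cycle⇒F≡0 {n@(suc _)} D (inj₁ (_ , v , arcs)) = nonempty-ZFS⇒F≡0 D zero (cycle⇒ZFS D v arcs)
cycle⇒F≡0 D (inj₂ (refl , _)) = nonempty-ZFS⇒F≡0 D zero
  (λ { S (zero , 0∈S) → 0 , universal⇒≡⊤ (λ { zero → 0∈S }) })

theorem2p4 : (n : ℕ) .{{_ : NonZero n}} (D : Digraph n) →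
    IsFailedZeroForcingNumber D 0 ⇔ IsDirectedCycle D
theorem2p4 n D = mk⇔ (F≡0⇒cycle D) (cycle⇒F≡0 D)
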